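{- Let $\lambda$ be a real number, let $\Lambda=\{\lambda_n\}_{n\ge0}$ be the constant sequence $\lambda_n=\lambda$ for all $n\ge 0$, and let $n\ge 0$ and $m\ge 1$ be integers. Then $(V_n[\Lambda])^m$ is the vertically-recurrent matrix whose associated sequence is $$\lambda^m\left(\frac{\lambda^m-1}{\lambda-1}\right)^{i},\qquad i\ge 0,$$ that is, $(V_n[\Lambda])^m=V_n[\Lambda^{(m)}]$ with $\Lambda^{(m)}=\bigl\{\lambda^m\bigl(\tfrac{\lambda^m-1}{\lambda-1}\bigr)^{i}\bigr\}_{i\ge0}$. Here $\frac{\lambda^m-1}{\lambda-1}$ is understood as $1+\lambda+\cdots+\lambda^{m-1}$ (so it equals $m$ when $\lambda=1$), and $x^0=1$ for all $x$.
   Context: Rows and columns of matrices are indexed from $0$. Given a sequence $\Lambda=\{\lambda_n\}_{n\ge0}$ of real numbers (with no normalization of $\lambda_0$ required), define numbers $a_{i,j}$ ($i,j\ge 0$) by $a_{i,0}=\lambda_i$ for $i\ge 0$, $a_{i,j}=0$ for $i<j$, and $$a_{i,j}=\sum_{l=j-1}^{i-1}\lambda_{i-1-l}\,a_{l,j-1}\qquad (i\ge j\ge 1).$$ The vertically-recurrent matrix with associated sequence $\Lambda$, of order $(n+1)\times(n+1)$, is $V_n[\Lambda]=[a_{i,j}]_{0\le i,j\le n}$. -}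

module Defs where

open import Algebra.Bundles using (CommutativeRing; Semiring)
open import Data.Bool.Base using (if_then_else_)
open import Data.Fin.Base using (Fin; toℕ)
open import Data.Fin.Properties using (_≟_)
open import Data.Nat.Base as ℕ using (ℕ; zero; suc; _∸_)
open import Relation.Nullary.Decidable.Core using (does)

module VerticallyRecurrent {c ℓ} (R : CommutativeRing c ℓ) where

  open CommutativeRing R
  open import Algebra.Definitions.RawSemiring (Semiring.rawSemiring semiring) public using (_^_; sum)

  -- Half-open: Σ_{a ≤ l < b} f l, which is the empty sum when b ≤ a.
  sumFromTo : ℕ → ℕ → (ℕ → Carrier) → Carrier
  sumFromTo a b f = sum {n = b ∸ a} λ k → f (a ℕ.+ toℕ k)

  -- The summation index l runs over j - 1 ≤ l ≤ i - 1 when the column index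
  -- is j; below the column index is written suc j.  For i < suc j the range is
  -- empty, so the entries above the diagonal are 0#.
  entry : (ℕ → Carrier) → ℕ → ℕ → Carrier
  entry Λ i zero    = Λ i
  entry Λ i (suc j) = sumFromTo j i λ l → Λ (i ∸ 1 ∸ l) * entry Λ l j

  SquareMatrix : ℕ → Set c
  SquareMatrix n = Fin n → Fin n → Carrier

  infix 4 _≈ᴹ_
  _≈ᴹ_ : ∀ {n} → SquareMatrix n → SquareMatrix n → Set ℓ
  A ≈ᴹ B = ∀ i j → A i j ≈ B i j

  1ᴹ : ∀ {n} → SquareMatrix n
  1ᴹ i j = if does (i ≟ j) then 1# else 0#

  infixl 7 _*ᴹ_
  _*ᴹ_ : ∀ {n} → SquareMatrix n → SquareMatrix n → SquareMatrix n
  (A *ᴹ B) i j = sum λ k → A i k * B k j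

  infixr 8 _^ᴹ_
  _^ᴹ_ : ∀ {n} → SquareMatrix n → ℕ → SquareMatrix n
  A ^ᴹ zero  = 1ᴹ
  A ^ᴹ suc m = A *ᴹ (A ^ᴹ m)

  -- Order (n + 1) × (n + 1).
  V : ∀ n → (ℕ → Carrier) → SquareMatrix (suc n)
  V n Λ i j = entry Λ (toℕ i) (toℕ j)

  -- 1 + x + ⋯ + x^(m-1), the division-free reading of (x^m - 1) / (x - 1).
  geometricSum : Carrier → ℕ → Carrier
  geometricSum x m = sum {n = m} λ k → x ^ toℕ k

{-# OPTIONS --safe #-}
module Submission where

-- When Λ is geometric with ratio b and first term a, the entries of its
-- vertically-recurrent matrix obey a Pascal-type rule: each entry is b times the
-- one above it plus a times the one above and to the left.  Such matrices are
-- closed under products, (a , b) times (c , d) being (a c , b + a d).  Starting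
-- from the identity, which is (1 , 0), and multiplying m times on the left by
-- (x , 1) gives (x^m , 1 + x + ⋯ + x^(m-1)).

open import Defs
open import Algebra.Bundles using (CommutativeRing)
open import Data.Fin.Base as Fin using (Fin; toℕ)
open import Data.Fin.Properties using (toℕ<n)
open import Data.Nat.Base as ℕ using (ℕ; zero; suc; _≤_; _<_; _∸_; s≤s; s<s⁻¹; z<s)
open import Data.Nat.Properties as ℕₚ using (≤-<-connex)
open import Data.Sum.Base using (inj₁; inj₂)
open import Function.Base using (_∘_)
open import Relation.Binary.PropositionalEquality as ≡ using ()

module _ {c ℓ} (R : CommutativeRing c ℓ) where

  open CommutativeRing R
  open VerticallyRecurrent R
  open import Algebra.Properties.Semiring.Sum semiring
    using (*-distribˡ-sum; sum-cong-≋; sum-replicate-zero; ∑-distrib-+)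
  open import Algebra.Properties.CommutativeSemigroup *-commutativeSemigroup
    using (x∙yz≈y∙xz)
  open import Algebra.Solver.Ring.NaturalCoefficients.Default commutativeSemiring
    using (solve; _:=_; _:+_; _:*_)
  open import Relation.Binary.Reasoning.Setoid setoid

  -- `sum` unfolds at its first term, whereas passing to the next row of `entry` extends the sum at
  -- its last.
  sum-snoc : ∀ n (f : ℕ → Carrier) →
             sum {n = suc n} (f ∘ toℕ) ≈ sum {n = n} (f ∘ toℕ) + f n
  sum-snoc zero    f = trans (+-identityʳ _) (sym (+-identityˡ _))
  sum-snoc (suc n) f = trans (+-congˡ (sum-snoc n (f ∘ suc))) (sym (+-assoc _ _ _))

  sum-linear : ∀ n u v (f g : Fin n → Carrier) →
               sum (λ k → u * f k + v * g k) ≈ u * sum f + v * sum g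
  sum-linear n u v f g =
    trans (∑-distrib-+ (λ k → u * f k) (λ k → v * g k))
          (+-cong (sym (*-distribˡ-sum u f)) (sym (*-distribˡ-sum v g)))

  sumFromTo-snoc : ∀ {a b} → a ≤ b → ∀ f →
                   sumFromTo a (suc b) f ≈ sumFromTo a b f + f b
  sumFromTo-snoc {a} {b} a≤b f rewrite ℕₚ.+-∸-assoc 1 a≤b =
    trans (sum-snoc (b ∸ a) (f ∘ (a ℕ.+_)))
          (+-congˡ (reflexive (≡.cong f (ℕₚ.m+[n∸m]≡n a≤b))))

  sumFromTo-cong : ∀ {a b} → a ≤ b → ∀ f g → (∀ l → l < b → f l ≈ g l) →
                   sumFromTo a b f ≈ sumFromTo a b g
  sumFromTo-cong {a} a≤b f g f≈g = sum-cong-≋ λ k →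
    f≈g (a ℕ.+ toℕ k)
        (≡.subst (a ℕ.+ toℕ k <_) (ℕₚ.m+[n∸m]≡n a≤b) (ℕₚ.+-monoʳ-< a (toℕ<n k)))

  sumFromTo-empty : ∀ {a b} → b ≤ a → ∀ f → sumFromTo a b f ≈ 0#
  sumFromTo-empty b≤a f rewrite ℕₚ.m≤n⇒m∸n≡0 b≤a = refl

  entry-upper : ∀ Λ i j → i < j → entry Λ i j ≈ 0#
  entry-upper Λ i (suc j) (s≤s i≤j) =
    sumFromTo-empty i≤j λ l → Λ (i ∸ 1 ∸ l) * entry Λ l j

  -- A recurrence needs no division, so the ratio may be `0#`, as it is for the identity matrix.
  Geometric : (ℕ → Carrier) → Carrier → Set ℓ
  Geometric Λ b = ∀ i → Λ (suc i) ≈ b * Λ i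

  Geometric-∸ : ∀ {Λ b} → Geometric Λ b → ∀ {i l} → l < i → Λ (i ∸ l) ≈ b * Λ (i ∸ 1 ∸ l)
  Geometric-∸ geo {suc i} {l} (s≤s l≤i) rewrite ℕₚ.+-∸-assoc 1 l≤i = geo (i ∸ l)

  -- Compared with the sum for row `i`, the one for row `suc i` has every old coefficient multiplied
  -- by `b` and one new term `l = i`, whose coefficient is `Λ 0`.
  entry-pascal : ∀ {Λ b} → Geometric Λ b → ∀ i j →
                 entry Λ (suc i) (suc j) ≈ b * entry Λ i (suc j) + Λ 0 * entry Λ i j
  entry-pascal {Λ} {b} geo i j with ≤-<-connex j i
  ... | inj₁ j≤i = begin
    entry Λ (suc i) (suc j)
      ≈⟨ sumFromTo-snoc j≤i (λ l → Λ (i ∸ l) * entry Λ l j) ⟩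
    sumFromTo j i (λ l → Λ (i ∸ l) * entry Λ l j) + Λ (i ∸ i) * entry Λ i j
      ≈⟨ +-cong (sumFromTo-cong j≤i (λ l → Λ (i ∸ l) * entry Λ l j) (λ l → b * term l) λ l l<i →
                   trans (*-congʳ (Geometric-∸ geo l<i)) (*-assoc _ _ _))
                (*-congʳ (reflexive (≡.cong Λ (ℕₚ.n∸n≡0 i)))) ⟩
    sumFromTo j i (λ l → b * term l) + Λ 0 * entry Λ i j
      ≈⟨ +-congʳ (sym (*-distribˡ-sum {n = i ∸ j} b λ k → term (j ℕ.+ toℕ k))) ⟩
    b * entry Λ i (suc j) + Λ 0 * entry Λ i j ∎
    where
    term : ℕ → Carrier
    term l = Λ (i ∸ 1 ∸ l) * entry Λ l j
  -- Here the range of summation is still empty in row `suc i`, so no last term can be split off;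
  -- all three entries vanish.
  ... | inj₂ i<j = begin
    entry Λ (suc i) (suc j)
      ≈⟨ entry-upper Λ (suc i) (suc j) (s≤s i<j) ⟩
    0#
      ≈⟨ +-identityˡ 0# ⟨
    0# + 0#
      ≈⟨ +-cong (zeroʳ b) (zeroʳ (Λ 0)) ⟨
    b * 0# + Λ 0 * 0#
      ≈⟨ +-cong (*-congˡ (entry-upper Λ i (suc j) (ℕₚ.m<n⇒m<1+n i<j))) (*-congˡ (entry-upper Λ i j i<j)) ⟨
    b * entry Λ i (suc j) + Λ 0 * entry Λ i j ∎

  -- One entry of a matrix product, with the column `f` of the right factor indexed by all of ℕ so
  -- that it can be shifted, and the length `N` kept separate from the row `i`.
  rowSum : (ℕ → Carrier) → ℕ → ℕ → (ℕ → Carrier) → Carrier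
  rowSum Λ N i f = sum {n = N} λ k → entry Λ i (toℕ k) * f (toℕ k)

  rowSum-zero : ∀ Λ N f → rowSum Λ (suc N) 0 f ≈ Λ 0 * f 0
  rowSum-zero Λ N f = begin
    Λ 0 * f 0 + sum {n = N} (λ k → entry Λ 0 (suc (toℕ k)) * f (suc (toℕ k)))
      ≈⟨ +-congˡ (sum-cong-≋ {n = N} λ k → trans (*-congʳ (entry-upper Λ 0 (suc (toℕ k)) z<s)) (zeroˡ _)) ⟩
    Λ 0 * f 0 + sum {n = N} (λ _ → 0#)
      ≈⟨ +-congˡ (sum-replicate-zero N) ⟩
    Λ 0 * f 0 + 0#
      ≈⟨ +-identityʳ _ ⟩
    Λ 0 * f 0 ∎

  -- Column 0 follows the ratio `b` and the other columns the Pascal rule. The upper-left entry in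
  -- column `k` meets `f (suc k)`, hence the shifted `f` and the shorter length in the last term.
  rowSum-suc : ∀ {Λ b} → Geometric Λ b → ∀ N i f →
               rowSum Λ (suc N) (suc i) f ≈
               b * rowSum Λ (suc N) i f + Λ 0 * rowSum Λ N i (f ∘ suc)
  rowSum-suc {Λ} {b} geo N i f = begin
    Λ (suc i) * f 0 + sum {n = N} (λ k → entry Λ (suc i) (suc (toℕ k)) * f (suc (toℕ k)))
      ≈⟨ +-cong (*-congʳ (geo i)) (sum-cong-≋ {n = N} λ k →
           trans (*-congʳ (entry-pascal geo i (toℕ k)))
                 (solve 5 (λ b a p q y → (b :* p :+ a :* q) :* y := b :* (p :* y) :+ a :* (q :* y))
                        refl b (Λ 0) (entry Λ i (suc (toℕ k))) (entry Λ i (toℕ k)) (f (suc (toℕ k))))) ⟩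
    b * Λ i * f 0 + sum {n = N} (λ k → b * upper k + Λ 0 * left k)
      ≈⟨ +-congˡ (sum-linear N b (Λ 0) upper left) ⟩
    b * Λ i * f 0 + (b * sum upper + Λ 0 * sum left)
      ≈⟨ solve 5 (λ b p y s t → b :* p :* y :+ (b :* s :+ t) := b :* (p :* y :+ s) :+ t)
               refl b (Λ i) (f 0) (sum upper) (Λ 0 * sum left) ⟩
    b * rowSum Λ (suc N) i f + Λ 0 * rowSum Λ N i (f ∘ suc) ∎
    where
    upper left : Fin N → Carrier
    upper k = entry Λ i (suc (toℕ k)) * f (suc (toℕ k))
    left  k = entry Λ i (toℕ k) * f (suc (toℕ k))

  rowSum-cong : ∀ Λ N i f g → (∀ k → f k ≈ g k) → rowSum Λ N i f ≈ rowSum Λ N i g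
  rowSum-cong Λ N i f g f≈g = sum-cong-≋ {n = N} λ k → *-congˡ (f≈g (toℕ k))

  rowSum-linear : ∀ Λ N i u v f g →
                  rowSum Λ N i (λ k → u * f k + v * g k) ≈ u * rowSum Λ N i f + v * rowSum Λ N i g
  rowSum-linear Λ N i u v f g = trans
    (sum-cong-≋ {n = N} λ k →
      solve 5 (λ e u v y z → e :* (u :* y :+ v :* z) := u :* (e :* y) :+ v :* (e :* z))
            refl (entry Λ i (toℕ k)) u v (f (toℕ k)) (g (toℕ k)))
    (sum-linear N u v _ _)

  rowSum-scale : ∀ Λ N i u f → rowSum Λ N i (λ k → u * f k) ≈ u * rowSum Λ N i f
  rowSum-scale Λ N i u f = trans
    (sum-cong-≋ {n = N} λ k → x∙yz≈y∙xz _ _ _)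
    (sym (*-distribˡ-sum {n = N} u _))

  module _ {Λ Μ Ν b d} (geoΛ : Geometric Λ b) (geoΜ : Geometric Μ d)
           (Ν₀ : Ν 0 ≈ Λ 0 * Μ 0) (geoΝ : Geometric Ν (b + Λ 0 * d)) where

    -- Induction on the row: both sides satisfy the same Pascal rule. The bound `i < N` survives the
    -- shift, which lowers row and length together.
    rowSum-entry : ∀ N i j → i < N → rowSum Λ N i (λ k → entry Μ k j) ≈ entry Ν i j
    rowSum-entry (suc N) zero zero    _ = trans (rowSum-zero Λ N Μ) (sym Ν₀)
    rowSum-entry (suc N) zero (suc j) _ = trans (rowSum-zero Λ N λ k → entry Μ k (suc j))
      (trans (*-congˡ (entry-upper Μ 0 (suc j) z<s)) (trans (zeroʳ _) (sym (entry-upper Ν 0 (suc j) z<s))))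
    rowSum-entry (suc N) (suc i) zero i<N = begin
      rowSum Λ (suc N) (suc i) Μ
        ≈⟨ rowSum-suc geoΛ N i Μ ⟩
      b * rowSum Λ (suc N) i Μ + Λ 0 * rowSum Λ N i (Μ ∘ suc)
        ≈⟨ +-cong (*-congˡ (rowSum-entry (suc N) i 0 (ℕₚ.<⇒≤ i<N)))
                  -- Shifting the first column of the right factor only multiplies it by `d`.
                  (*-congˡ (trans (rowSum-cong Λ N i (Μ ∘ suc) (λ k → d * Μ k) geoΜ)
                           (trans (rowSum-scale Λ N i d Μ)
                                  (*-congˡ (rowSum-entry N i 0 (s<s⁻¹ i<N)))))) ⟩
      b * Ν i + Λ 0 * (d * Ν i)
        ≈⟨ solve 4 (λ b a d y → b :* y :+ a :* (d :* y) := (b :+ a :* d) :* y)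
                 refl b (Λ 0) d (Ν i) ⟩
      (b + Λ 0 * d) * Ν i
        ≈⟨ geoΝ i ⟨
      Ν (suc i) ∎
    rowSum-entry (suc N) (suc i) (suc j) i<N = begin
      rowSum Λ (suc N) (suc i) (λ k → entry Μ k (suc j))
        ≈⟨ rowSum-suc geoΛ N i (λ k → entry Μ k (suc j)) ⟩
      b * rowSum Λ (suc N) i (λ k → entry Μ k (suc j)) +
      Λ 0 * rowSum Λ N i (λ k → entry Μ (suc k) (suc j))
        ≈⟨ +-cong (*-congˡ (rowSum-entry (suc N) i (suc j) (ℕₚ.<⇒≤ i<N)))
                  -- The Pascal rule for `Μ` turns the shifted column into a combination of columns
                  -- `suc j` and `j`, to which the induction hypothesis applies.
                  (*-congˡ (trans (rowSum-cong Λ N i (λ k → entry Μ (suc k) (suc j))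
                                         (λ k → d * entry Μ k (suc j) + Μ 0 * entry Μ k j)
                                         (λ k → entry-pascal geoΜ k j))
                           (trans (rowSum-linear Λ N i d (Μ 0) (λ k → entry Μ k (suc j)) (λ k → entry Μ k j))
                                  (+-cong (*-congˡ (rowSum-entry N i (suc j) (s<s⁻¹ i<N)))
                                          (*-congˡ (rowSum-entry N i j (s<s⁻¹ i<N))))))) ⟩
      b * entry Ν i (suc j) + Λ 0 * (d * entry Ν i (suc j) + Μ 0 * entry Ν i j)
        ≈⟨ solve 6 (λ b a d c y z → b :* y :+ a :* (d :* y :+ c :* z) :=
                                    (b :+ a :* d) :* y :+ a :* c :* z)
                 refl b (Λ 0) d (Μ 0) (entry Ν i (suc j)) (entry Ν i j) ⟩
      (b + Λ 0 * d) * entry Ν i (suc j) + Λ 0 * Μ 0 * entry Ν i j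
        ≈⟨ +-congˡ (*-congʳ Ν₀) ⟨
      (b + Λ 0 * d) * entry Ν i (suc j) + Ν 0 * entry Ν i j
        ≈⟨ entry-pascal geoΝ i j ⟨
      entry Ν (suc i) (suc j) ∎

    V-*ᴹ : ∀ n → V n Λ *ᴹ V n Μ ≈ᴹ V n Ν
    V-*ᴹ n i j = rowSum-entry (suc n) (toℕ i) (toℕ j) (toℕ<n i)

  -- With first term 1 and ratio 0 the Pascal rule makes entries constant along diagonals, and the
  -- first column is 1, 0, 0, and so on.
  entry-identity : ∀ {Λ} → Λ 0 ≈ 1# → Geometric Λ 0# →
                   ∀ {n} (i j : Fin n) → 1ᴹ i j ≈ entry Λ (toℕ i) (toℕ j)
  entry-identity Λ₀ geo Fin.zero    Fin.zero    = sym Λ₀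
  entry-identity {Λ} Λ₀ geo Fin.zero (Fin.suc j) = sym (entry-upper Λ 0 (suc (toℕ j)) z<s)
  entry-identity Λ₀ geo (Fin.suc i) Fin.zero    = sym (trans (geo (toℕ i)) (zeroˡ _))
  entry-identity {Λ} Λ₀ geo (Fin.suc i) (Fin.suc j) = begin
    -- The entry of `1ᴹ` at `Fin.suc i`, `Fin.suc j` reduces to this one by computation.
    1ᴹ i j
      ≈⟨ entry-identity Λ₀ geo i j ⟩
    entry Λ (toℕ i) (toℕ j)
      ≈⟨ trans (+-cong (zeroˡ _) (*-identityˡ _)) (+-identityˡ _) ⟨
    0# * entry Λ (toℕ i) (suc (toℕ j)) + 1# * entry Λ (toℕ i) (toℕ j)
      ≈⟨ +-congˡ (*-congʳ Λ₀) ⟨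
    0# * entry Λ (toℕ i) (suc (toℕ j)) + Λ 0 * entry Λ (toℕ i) (toℕ j)
      ≈⟨ entry-pascal geo (toℕ i) (toℕ j) ⟨
    entry Λ (suc (toℕ i)) (suc (toℕ j)) ∎

  -- The right side is the ratio `b + Λ 0 * d` that arises when the left factor has first term `x`
  -- and ratio 1.
  geometricSum-suc : ∀ x m → geometricSum x (suc m) ≈ 1# + x * geometricSum x m
  geometricSum-suc x m = +-congˡ (sym (*-distribˡ-sum {n = m} x (λ k → x ^ toℕ k)))

  ^-geometric : ∀ a b → Geometric (λ i → a * b ^ i) b
  ^-geometric a b i = x∙yz≈y∙xz a b (b ^ i)

  V-^ᴹ : ∀ x n m → V n (λ _ → x) ^ᴹ m ≈ᴹ V n (λ i → x ^ m * geometricSum x m ^ i)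
  -- The empty geometric sum is `0#`, so the sequence is `1# * 0# ^ i`, whose term at 0 is 1 because
  -- `0# ^ 0` is `1#`.
  V-^ᴹ x n zero    = entry-identity (*-identityˡ 1#) (^-geometric 1# 0#)
  V-^ᴹ x n (suc m) i j = trans
    (sum-cong-≋ {n = suc n} λ k → *-congˡ {x = V n (λ _ → x) i k} (V-^ᴹ x n m k j))
    (V-*ᴹ {Λ = λ _ → x} {Μ = λ i → x ^ m * geometricSum x m ^ i}
          {Ν = λ i → x ^ suc m * geometricSum x (suc m) ^ i}
          -- The constant sequence has ratio `1#`, which is the `b` of the product rule.
          (λ _ → sym (*-identityˡ x)) (^-geometric (x ^ m) (geometricSum x m))
          (*-assoc x (x ^ m) 1#)
          (λ i → trans (^-geometric (x ^ suc m) (geometricSum x (suc m)) i)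
                       (*-congʳ (geometricSum-suc x m)))
          n i j)

proposition3p1 : ∀ {c ℓ} (R : CommutativeRing c ℓ) →
    let open CommutativeRing R
        open VerticallyRecurrent R
    in ∀ (x : Carrier) (n m : ℕ) → 1 ≤ m →
       V n (λ _ → x) ^ᴹ m ≈ᴹ V n (λ i → x ^ m * geometricSum x m ^ i)
proposition3p1 R x n m _ = V-^ᴹ R x n m
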